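{- The proof system $\mathbb{SPALD}$ is sound with respect to the class of all models: for every $\phi\in\mathcal{L}$, if $\phi$ is provable in $\mathbb{SPALD}$ then $\mathcal{M},w\vDash\phi$ for every model $\mathcal{M}$ and every world $w$ of $\mathcal{M}$.
   Context: Fix a countable set $\mathsf{Prop}$ of proposition letters and a finite set $I$ of agents. **Language.** The boolean language $\mathcal{L}_B$ is $P ::= p \mid \lnot P \mid (P\land P)$ with $p\in\mathsf{Prop}$. The full language $\mathcal{L}$ is $\phi ::= P \mid P\equiv P \mid \lnot\phi \mid (\phi\land\phi)\mid \Box_i\phi \mid [\phi]\phi$ with $P\in\mathcal{L}_B$, $i\in I$ (the boolean connectives $\lnot,\land$ of the two layers are the same). Abbreviations: $\phi\lor\psi:=\lnot(\lnot\phi\land\lnot\psi)$, $\phi\to\psi:=\lnot\phi\lor\psi$, $\phi\leftrightarrow\psi:=(\phi\to\psi)\land(\psi\to\phi)$, and $P\not\equiv Q:=\lnot(P\equiv Q)$. Parentheses matter: boolean formulas are syntactic objects and $=$ between them is syntactic identity. **Models.** A premodel is $\mathcal{M}=(W,R,V,\mathsf{DEF})$ with $W$ a non-empty set, $R_i\subseteq W\times W$ for each $i\in I$ (no frame conditions), $V\colon W\to\mathsf{Prop}\to\{0,1\}$, and $\mathsf{DEF}\colon W\to\mathsf{Prop}\to\mathcal{L}_B$. $V_w$ is extended to $\mathcal{L}_B$ by the usual boolean truth tables. Define $\mathsf{def}_w\colon\mathcal{L}_B\to\mathcal{L}_B$ by $\mathsf{def}_w(p)=\mathsf{DEF}_w(p)$,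 $\mathsf{def}_w(\lnot P)=\lnot\mathsf{def}_w(P)$, $\mathsf{def}_w((P_1\land P_2))=(\mathsf{def}_w(P_1)\land\mathsf{def}_w(P_2))$. A premodel is a model iff for all worlds $w$: (1) for all $P,Q\in\mathcal{L}_B$, if $\mathsf{def}_w(P)=\mathsf{def}_w(Q)$ then $V_w(P)=V_w(Q)$; (2) for all $p,q\in\mathsf{Prop}$, if $p$ occurs in $\mathsf{DEF}_w(q)$ then $\mathsf{DEF}_w(p)=p$. **Semantics.** $\mathcal{M},w\vDash p$ iff $V_w(p)=1$; $\mathcal{M},w\vDash P_1\equiv P_2$ iff $\mathsf{def}_w(P_1)=\mathsf{def}_w(P_2)$ (syntactic identity); $\lnot,\land$ as usual; $\mathcal{M},w\vDash\Box_i\phi$ iff $\mathcal{M},v\vDash\phi$ for all $v$ with $wR_iv$; $\mathcal{M},w\vDash[\phi]\psi$ iff $\mathcal{M},w\vDash\phi$ implies $\mathcal{M}^\phi,w\vDash\psi$, where $\mathcal{M}^\phi$ is the restriction of $\mathcal{M}$ to $\{v\in W\mid\mathcal{M},v\vDash\phi\}$ (relations, valuation and definitions restricted). **Proof system $\mathbb{SPALD}$.** Axiom schemes ($\phi,\psi,\theta,\xi\in\mathcal{L}$; $P,Q,R,S\in\mathcal{L}_B$; $p\in\mathsf{Prop}$; $i\in I$): - all propositional tautologies; - $\Box_i(\phi\to\psi)\to(\Box_i\phi\to\Box_i\psi)$; - PAL reduction axioms: $[\phi]p\leftrightarrow(\phi\to p)$; $[\phi](P\equiv Q)\leftrightarrow(\phi\to(P\equiv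 Q))$; $[\phi]\lnot\psi\leftrightarrow(\phi\to\lnot[\phi]\psi)$; $[\phi](\psi\land\theta)\leftrightarrow([\phi]\psi\land[\phi]\theta)$; $[\phi]\Box_i\psi\leftrightarrow(\phi\to\Box_i(\phi\to[\phi]\psi))$; $[\phi][\psi]\xi\leftrightarrow[\phi\land[\phi]\psi]\xi$; - definition axioms: reflexivity $P\equiv P$; symmetry $(P\equiv Q)\to(Q\equiv P)$; transitivity $((P\equiv Q)\land(Q\equiv R))\to(P\equiv R)$; equivalence $(P\equiv Q)\to(P\leftrightarrow Q)$; atomic occurrence substitution $((p\equiv Q)\land(R\equiv S))\to(R\equiv[k\mathopen: p\mapsto Q]S)$, where $[k\mathopen: p\mapsto Q]S$ is the result of replacing the $k$-th occurrence of $p$ in $S$ by $Q$; pattern $\lnot$: $(\lnot P\equiv\lnot Q)\leftrightarrow(P\equiv Q)$; pattern $\land$: $((P\land Q)\equiv(R\land S))\leftrightarrow((P\equiv R)\land(Q\equiv S))$; pattern mismatch: $\lnot P\not\equiv(Q\land R)$; non-circularity: $p\not\equiv P$ whenever $p$ occurs in $P$ and $P\neq p$. Rules: modus ponens (from $\phi$ and $\phi\to\psi$ infer $\psi$) and necessitation (from $\vdash\phi$ infer $\vdash\Box_i\phi$). -}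

module Defs where

open import Data.Bool.Base using (Bool; true; not; if_then_else_) renaming (_∧_ to _∧ᵇ_)
open import Data.Nat.Base using (ℕ; zero; suc; _+_; _∸_; _≡ᵇ_)
open import Data.Nat.Properties using (≡-decSetoid)
open import Data.Product.Base using (Σ; _×_; _,_; proj₁)
open import Function.Bundles using (_↣_)
open import Level using (Level; Lift) renaming (suc to lsuc)
open import Relation.Binary.Bundles using (DecSetoid)
open import Relation.Binary.Definitions using (DecidableEquality)
open import Relation.Binary.PropositionalEquality.Core using (_≡_; _≢_)
open import Relation.Nullary.Decidable.Core using (does)
open import Relation.Nullary.Decidable using (via-injection)
open import Relation.Nullary.Negation.Core using (¬_)

-- Countability of the proposition letters is given by an injection into ℕ,
-- which in particular makes their equality decidable.
module SPALD (Letter : Set) (countable : Letter ↣ ℕ) (Agent : Set) where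

  _≟_ : DecidableEquality Letter
  _≟_ = via-injection countable (DecSetoid._≟_ ≡-decSetoid)

  infix  9 `_
  infix  8 ~_ □_·_
  infixr 8 [_]_
  infixr 7 _&_
  infixr 6 _∨_
  infix  5 _≣_ _≢≣_
  infixr 4 _⇒_
  infix  3 _⇔_

  data BForm : Set where
    `_  : Letter → BForm
    ~_  : BForm → BForm
    _&_ : BForm → BForm → BForm

  -- The connectives of the two layers are the same, so a boolean formula has
  -- a single reading as a formula, namely its image under ⌜_⌝; accordingly
  -- only letters, and not all boolean formulas, are a base case here.
  data Form : Set where
    `_   : Letter → Form
    _≣_  : BForm → BForm → Form
    ~_   : Form → Form
    _&_  : Form → Form → Form
    □_·_ : Agent → Form → Form
    [_]_ : Form → Form → Form

  ⌜_⌝ : BForm → Form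
  ⌜ ` p ⌝   = ` p
  ⌜ ~ P ⌝   = ~ ⌜ P ⌝
  ⌜ P & Q ⌝ = ⌜ P ⌝ & ⌜ Q ⌝

  _∨_ : Form → Form → Form
  φ ∨ ψ = ~ (~ φ & ~ ψ)

  _⇒_ : Form → Form → Form
  φ ⇒ ψ = ~ φ ∨ ψ

  _⇔_ : Form → Form → Form
  φ ⇔ ψ = (φ ⇒ ψ) & (ψ ⇒ φ)

  _≢≣_ : BForm → BForm → Form
  P ≢≣ Q = ~ (P ≣ Q)

  data _OccursIn_ (p : Letter) : BForm → Set where
    here  : p OccursIn (` p)
    neg   : ∀ {P} → p OccursIn P → p OccursIn (~ P)
    left  : ∀ {P Q} → p OccursIn P → p OccursIn (P & Q)
    right : ∀ {P Q} → p OccursIn Q → p OccursIn (P & Q)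

  occurrences : Letter → BForm → ℕ
  occurrences p (` q)   = if does (p ≟ q) then 1 else 0
  occurrences p (~ P)   = occurrences p P
  occurrences p (P & Q) = occurrences p P + occurrences p Q

  -- Occurrences are numbered from 1, left to right; for k = 0 or k larger than
  -- the number of occurrences, nothing is replaced.  In a conjunction whose
  -- left part contains the k-th occurrence, the truncated subtraction gives
  -- index 0 for the right part, which is thus left unchanged.
  [_∶_↦_]_ : ℕ → Letter → BForm → BForm → BForm
  [ k ∶ p ↦ Q ] (` q)   = if does (p ≟ q) ∧ᵇ (k ≡ᵇ 1) then Q else ` q
  [ k ∶ p ↦ Q ] (~ S)   = ~ ([ k ∶ p ↦ Q ] S)
  [ k ∶ p ↦ Q ] (S & T) = ([ k ∶ p ↦ Q ] S) & ([ k ∸ occurrences p S ∶ p ↦ Q ] T)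

  value : (Letter → Bool) → BForm → Bool
  value V (` p)   = V p
  value V (~ P)   = not (value V P)
  value V (P & Q) = value V P ∧ᵇ value V Q

  def : (Letter → BForm) → BForm → BForm
  def D (` p)   = D p
  def D (~ P)   = ~ def D P
  def D (P & Q) = def D P & def D Q

  record Premodel (ℓ : Level) : Set (lsuc ℓ) where
    field
      World    : Set ℓ
      nonempty : World
      R        : Agent → World → World → Set ℓ
      V        : World → Letter → Bool
      DEF      : World → Letter → BForm

  open Premodel public

  record IsModel {ℓ} (M : Premodel ℓ) : Set ℓ where
    field
      respectsDef : ∀ w P Q → def (DEF M w) P ≡ def (DEF M w) Q →
                    value (V M w) P ≡ value (V M w) Q
      fixedDEF    : ∀ w p q → p OccursIn DEF M w q → DEF M w p ≡ ` p

  record Model (ℓ : Level) : Set (lsuc ℓ) where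
    field
      premodel : Premodel ℓ
      isModel  : IsModel premodel

  open Model public

  restrict : ∀ {ℓ} (M : Premodel ℓ) (S : World M → Set ℓ) → Σ (World M) S → Premodel ℓ
  restrict M S s .World    = Σ (World M) S
  restrict M S s .nonempty = s
  restrict M S s .R i v u  = R M i (proj₁ v) (proj₁ u)
  restrict M S s .V v      = V M (proj₁ v)
  restrict M S s .DEF v    = DEF M (proj₁ v)

  infix 2 _,_⊨_

  _,_⊨_ : ∀ {ℓ} (M : Premodel ℓ) → World M → Form → Set ℓ
  _,_⊨_ {ℓ} M w (` p)   = Lift ℓ (V M w p ≡ true)
  _,_⊨_ {ℓ} M w (P ≣ Q) = Lift ℓ (def (DEF M w) P ≡ def (DEF M w) Q)
  M , w ⊨ ~ φ           = ¬ (M , w ⊨ φ)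
  M , w ⊨ φ & ψ         = (M , w ⊨ φ) × (M , w ⊨ ψ)
  M , w ⊨ □ i · φ       = ∀ v → R M i w v → M , v ⊨ φ
  M , w ⊨ [ φ ] ψ       = (h : M , w ⊨ φ) → restrict M (λ v → M , v ⊨ φ) (w , h) , (w , h) ⊨ ψ

  -- Propositional evaluation of a formula, in which v is consulted only at
  -- the subformulas that are neither negations nor conjunctions.
  eval : (Form → Bool) → Form → Bool
  eval v (~ φ)         = not (eval v φ)
  eval v (φ & ψ)       = eval v φ ∧ᵇ eval v ψ
  eval v φ@(` _)       = v φ
  eval v φ@(_ ≣ _)     = v φ
  eval v φ@(□ _ · _)   = v φ
  eval v φ@([ _ ] _)   = v φ

  Tautology : Form → Set
  Tautology φ = ∀ v → eval v φ ≡ true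

  infix 2 ⊢_

  data ⊢_ : Form → Set where
    taut        : ∀ {φ} → Tautology φ → ⊢ φ
    K           : ∀ i φ ψ → ⊢ □ i · (φ ⇒ ψ) ⇒ (□ i · φ ⇒ □ i · ψ)

    ann-letter  : ∀ φ p → ⊢ [ φ ] (` p) ⇔ (φ ⇒ ` p)
    ann-≣       : ∀ φ P Q → ⊢ [ φ ] (P ≣ Q) ⇔ (φ ⇒ (P ≣ Q))
    ann-~       : ∀ φ ψ → ⊢ [ φ ] (~ ψ) ⇔ (φ ⇒ ~ ([ φ ] ψ))
    ann-&       : ∀ φ ψ θ → ⊢ [ φ ] (ψ & θ) ⇔ (([ φ ] ψ) & ([ φ ] θ))
    ann-□       : ∀ φ i ψ → ⊢ [ φ ] (□ i · ψ) ⇔ (φ ⇒ □ i · (φ ⇒ [ φ ] ψ))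
    ann-ann     : ∀ φ ψ ξ → ⊢ [ φ ] ([ ψ ] ξ) ⇔ [ φ & ([ φ ] ψ) ] ξ

    ≣-refl      : ∀ P → ⊢ P ≣ P
    ≣-sym       : ∀ P Q → ⊢ (P ≣ Q) ⇒ (Q ≣ P)
    ≣-trans     : ∀ P Q R → ⊢ ((P ≣ Q) & (Q ≣ R)) ⇒ (P ≣ R)
    ≣-equiv     : ∀ P Q → ⊢ (P ≣ Q) ⇒ (⌜ P ⌝ ⇔ ⌜ Q ⌝)
    ≣-subst     : ∀ k p Q R S → ⊢ ((` p ≣ Q) & (R ≣ S)) ⇒ (R ≣ [ k ∶ p ↦ Q ] S)
    ≣-~         : ∀ P Q → ⊢ (~ P ≣ ~ Q) ⇔ (P ≣ Q)
    ≣-&         : ∀ P Q R S → ⊢ ((P & Q) ≣ (R & S)) ⇔ ((P ≣ R) & (Q ≣ S))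
    ≣-mismatch  : ∀ P Q R → ⊢ ~ P ≢≣ (Q & R)
    ≣-noncirc   : ∀ p P → p OccursIn P → P ≢ ` p → ⊢ ` p ≢≣ P

    mp          : ∀ {φ ψ} → ⊢ φ → ⊢ φ ⇒ ψ → ⊢ ψ
    nec         : ∀ i {φ} → ⊢ φ → ⊢ □ i · φ

{-# OPTIONS --safe #-}
-- Satisfaction is built from decidable atoms by ¬, × and Π only, so it is
-- stable under double negation; hence the defined connective ⇒ is implication,
-- and propositional tautologies may be checked by classically deciding the
-- finitely many propositional atoms of a formula.  The worlds of a restricted
-- model carry satisfaction proofs, so the reduction axioms hold up to
-- bisimulation: satisfaction does not depend on which proof is carried, and
-- restricting to φ and then to ψ is bisimilar to restricting to φ & [ φ ] ψ.
-- Non-circularity holds because def maps proper subformulas to proper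
-- subformulas.
module Submission where

open import Defs
open import Data.Bool.Base using (Bool; true; false; T; if_then_else_) renaming (_∧_ to _∧ᵇ_)
open import Data.Bool.Properties using (T-∧; T?) renaming (_≟_ to _≟ᵇ_)
open import Data.Fin.Base using (Fin)
import Data.Fin.Properties as Fin
open import Data.List.Base using (List; []; _∷_; _++_)
open import Data.List.Relation.Unary.All as All using (All; []; _∷_)
open import Data.List.Relation.Unary.All.Properties using (++⁻ˡ; ++⁻ʳ)
open import Data.Nat.Base using (ℕ; suc; _+_; _∸_; _≡ᵇ_; _≤_; s≤s)
open import Data.Nat.Properties using (≤-refl; ≤-reflexive; ≤-trans; m≤n⇒m≤1+n; m≤n⇒m≤n+o; m≤n⇒m≤o+n; 1+n≰n)
open import Data.Product.Base using (∃; _×_; _,_; proj₁; proj₂; uncurry)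
open import Function.Base using (flip; _∘_)
open import Function.Bundles using (_↣_; _↔_; module Equivalence)
open import Function.Properties.Inverse using (↔⇒↣)
open import Level using (Level; Lift; lift; lower)
open import Relation.Binary.Definitions using (DecidableEquality)
open import Relation.Binary.PropositionalEquality
  using (_≡_; refl; sym; trans; cong; cong₂; subst)
open import Relation.Nullary.Decidable using (no; does; proof; ⌊_⌋; map′; _×-dec_; decidable-stable; toWitness; fromWitness; via-injection; ¬¬-excluded-middle)
open import Relation.Nullary.Negation using (¬_; contradiction; Stable)
open import Relation.Nullary.Reflects using (Reflects; ofʸ; ofⁿ; invert; ¬-reflects; _×-reflects_)

module Soundness (Letter : Set) (countable : Letter ↣ ℕ)
                 (Agent : Set) (_≟ᴬ_ : DecidableEquality Agent) where

  open SPALD Letter countable Agent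

  -- Decidable equality of formulas

  _≟ᴮ_ : DecidableEquality BForm
  (` p)   ≟ᴮ (` q)   = map′ (cong `_) (λ { refl → refl }) (p ≟ q)
  (` _)   ≟ᴮ (~ _)   = no λ ()
  (` _)   ≟ᴮ (_ & _) = no λ ()
  (~ _)   ≟ᴮ (` _)   = no λ ()
  (~ P)   ≟ᴮ (~ Q)   = map′ (cong ~_) (λ { refl → refl }) (P ≟ᴮ Q)
  (~ _)   ≟ᴮ (_ & _) = no λ ()
  (_ & _) ≟ᴮ (` _)   = no λ ()
  (_ & _) ≟ᴮ (~ _)   = no λ ()
  (P & Q) ≟ᴮ (R & S) =
    map′ (uncurry (cong₂ _&_)) (λ { refl → refl , refl }) (P ≟ᴮ R ×-dec Q ≟ᴮ S)

  -- Deciding equality through a boolean test spares the 30 off-diagonal cases.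
  _==_ : Form → Form → Bool
  (` p)     == (` q)     = ⌊ p ≟ q ⌋
  (P ≣ Q)   == (R ≣ S)   = ⌊ P ≟ᴮ R ×-dec Q ≟ᴮ S ⌋
  (~ φ)     == (~ ψ)     = φ == ψ
  (φ & ψ)   == (θ & ξ)   = φ == θ ∧ᵇ ψ == ξ
  (□ i · φ) == (□ j · ψ) = ⌊ i ≟ᴬ j ⌋ ∧ᵇ φ == ψ
  ([ φ ] ψ) == ([ θ ] ξ) = φ == θ ∧ᵇ ψ == ξ
  _         == _         = false

  ==⇒≡ : ∀ φ ψ → T (φ == ψ) → φ ≡ ψ
  ==⇒≡ (` p) (` q) t = cong `_ (toWitness {a? = p ≟ q} t)
  ==⇒≡ (P ≣ Q) (R ≣ S) t =
    uncurry (cong₂ _≣_) (toWitness {a? = P ≟ᴮ R ×-dec Q ≟ᴮ S} t)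
  ==⇒≡ (~ φ) (~ ψ) t = cong ~_ (==⇒≡ φ ψ t)
  ==⇒≡ (φ & ψ) (θ & ξ) t with s , u ← Equivalence.to T-∧ t =
    cong₂ _&_ (==⇒≡ φ θ s) (==⇒≡ ψ ξ u)
  ==⇒≡ (□ i · φ) (□ j · ψ) t with s , u ← Equivalence.to T-∧ t =
    cong₂ □_·_ (toWitness {a? = i ≟ᴬ j} s) (==⇒≡ φ ψ u)
  ==⇒≡ ([ φ ] ψ) ([ θ ] ξ) t with s , u ← Equivalence.to T-∧ t =
    cong₂ [_]_ (==⇒≡ φ θ s) (==⇒≡ ψ ξ u)

  ==-refl : ∀ φ → T (φ == φ)
  ==-refl (` p)     = fromWitness {a? = p ≟ p} refl
  ==-refl (P ≣ Q)   = fromWitness {a? = P ≟ᴮ P ×-dec Q ≟ᴮ Q} (refl , refl)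
  ==-refl (~ φ)     = ==-refl φ
  ==-refl (φ & ψ)   = Equivalence.from T-∧ (==-refl φ , ==-refl ψ)
  ==-refl (□ i · φ) = Equivalence.from T-∧ (fromWitness {a? = i ≟ᴬ i} refl , ==-refl φ)
  ==-refl ([ φ ] ψ) = Equivalence.from T-∧ (==-refl φ , ==-refl ψ)

  _≟ᶠ_ : DecidableEquality Form
  φ ≟ᶠ ψ = map′ (==⇒≡ φ ψ) (λ { refl → ==-refl φ }) (T? (φ == ψ))

  -- Definitions: substitution and non-circularity

  def-cong : ∀ {D E : Letter → BForm} → (∀ p → D p ≡ E p) → ∀ P → def D P ≡ def E P
  def-cong eq (` p)   = eq p
  def-cong eq (~ P)   = cong ~_ (def-cong eq P)
  def-cong eq (P & Q) = cong₂ _&_ (def-cong eq P) (def-cong eq Q)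

  -- Each occurrence of `p` contributes `D p`, which is also what `Q` contributes, so it does not
  -- matter which occurrence `k` selects, if any.
  def-subst : ∀ D k p Q → D p ≡ def D Q → ∀ S → def D S ≡ def D ([ k ∶ p ↦ Q ] S)
  def-subst D k p Q eq (` q) with does (p ≟ q) | proof (p ≟ q) | k ≡ᵇ 1
  ... | true  | ofʸ refl | true  = eq
  ... | true  | ofʸ refl | false = refl
  ... | false | _        | _     = refl
  def-subst D k p Q eq (~ S)   = cong ~_ (def-subst D k p Q eq S)
  def-subst D k p Q eq (S & U) =
    cong₂ _&_ (def-subst D k p Q eq S) (def-subst D (k ∸ occurrences p S) p Q eq U)

  size : BForm → ℕ
  size (` _)   = 0
  size (~ P)   = suc (size P)
  size (P & Q) = suc (size P + size Q)

  -- An occurrence of `p` in `P` puts a copy of `D p` inside `def D P`.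
  size-def : ∀ D {p P} → p OccursIn P → size (D p) ≤ size (def D P)
  size-def D here      = ≤-refl
  size-def D (neg o)   = m≤n⇒m≤1+n (size-def D o)
  size-def D (left o)  = m≤n⇒m≤1+n (m≤n⇒m≤n+o _ (size-def D o))
  size-def D (right o) = m≤n⇒m≤1+n (m≤n⇒m≤o+n _ (size-def D o))

  def-noncircular : ∀ D {p P} → p OccursIn P → ¬ P ≡ ` p → ¬ D p ≡ def D P
  def-noncircular D here      P≢p _  = P≢p refl
  def-noncircular D (neg o)   _   eq =
    -- The outer connective lies strictly above the copy of `D p`, so the equation would give
    -- `suc (size (D p)) ≤ size (D p)`.
    1+n≰n (≤-trans (s≤s (size-def D o)) (≤-reflexive (cong size (sym eq))))
  def-noncircular D (left o)  _   eq =
    1+n≰n (≤-trans (s≤s (m≤n⇒m≤n+o _ (size-def D o))) (≤-reflexive (cong size (sym eq))))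
  def-noncircular D (right o) _   eq =
    1+n≰n (≤-trans (s≤s (m≤n⇒m≤o+n _ (size-def D o))) (≤-reflexive (cong size (sym eq))))

  -- Classical reasoning and tautologies

  atoms : Form → List Form
  atoms (~ φ)       = atoms φ
  atoms (φ & ψ)     = atoms φ ++ atoms ψ
  atoms φ@(` _)     = φ ∷ []
  atoms φ@(_ ≣ _)   = φ ∷ []
  atoms φ@(□ _ · _) = φ ∷ []
  atoms φ@([ _ ] _) = φ ∷ []

  update : (Form → Bool) → Form → Bool → Form → Bool
  update v φ b ψ = if does (ψ ≟ᶠ φ) then b else v ψ

  -- The premodel varies in the induction, since the announcement case passes to a restriction.
  ⊨-stable : ∀ {ℓ} (M : Premodel ℓ) w φ → Stable (M , w ⊨ φ)
  ⊨-stable M w (` p) nn =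
    lift (decidable-stable (V M w p ≟ᵇ true) λ k → nn (k ∘ lower))
  ⊨-stable M w (P ≣ Q) nn =
    lift (decidable-stable (def (DEF M w) P ≟ᴮ def (DEF M w) Q) λ k → nn (k ∘ lower))
  ⊨-stable M w (~ φ) nn h = nn λ k → k h
  ⊨-stable M w (φ & ψ) nn =
    ⊨-stable M w φ (λ k → nn (k ∘ proj₁)) , ⊨-stable M w ψ (λ k → nn (k ∘ proj₂))
  ⊨-stable M w (□ i · φ) nn v r = ⊨-stable M v φ λ k → nn λ f → k (f v r)
  ⊨-stable M w ([ φ ] ψ) nn h = ⊨-stable _ (w , h) ψ λ k → nn λ f → k (f h)

  module _ {ℓ} (M : Premodel ℓ) (w : World M) where

    ⇒-intro : ∀ φ ψ → (M , w ⊨ φ → M , w ⊨ ψ) → M , w ⊨ φ ⇒ ψ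
    ⇒-intro φ ψ f (nnφ , nψ) = nnφ (nψ ∘ f)

    -- `φ ⇒ ψ` unfolds to `¬ (¬ ¬ φ × ¬ ψ)`: introduction is constructive, while elimination rests
    -- on the stability of `ψ`.
    ⇒-elim : ∀ φ ψ → M , w ⊨ φ ⇒ ψ → M , w ⊨ φ → M , w ⊨ ψ
    ⇒-elim φ ψ f h = ⊨-stable M w ψ λ nψ → f ((λ nφ → nφ h) , nψ)

    ⇔-intro : ∀ φ ψ → (M , w ⊨ φ → M , w ⊨ ψ) → (M , w ⊨ ψ → M , w ⊨ φ) → M , w ⊨ φ ⇔ ψ
    ⇔-intro φ ψ f g = ⇒-intro φ ψ f , ⇒-intro ψ φ g

    letter-reflects : ∀ p → Reflects (M , w ⊨ ` p) (V M w p)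
    letter-reflects p with V M w p
    ... | true  = ofʸ (lift refl)
    ... | false = ofⁿ λ ()

    ⌜⌝-reflects : ∀ P → Reflects (M , w ⊨ ⌜ P ⌝) (value (V M w) P)
    ⌜⌝-reflects (` p)   = letter-reflects p
    ⌜⌝-reflects (~ P)   = ¬-reflects (⌜⌝-reflects P)
    ⌜⌝-reflects (P & Q) = ⌜⌝-reflects P ×-reflects ⌜⌝-reflects Q

    -- Turns the equality of boolean values that `respectsDef` provides into an implication between
    -- the embedded formulas.
    ⌜⌝-transfer : ∀ P Q → value (V M w) P ≡ value (V M w) Q → M , w ⊨ ⌜ P ⌝ → M , w ⊨ ⌜ Q ⌝
    ⌜⌝-transfer P Q eq h with value (V M w) P | value (V M w) Q | ⌜⌝-reflects P | ⌜⌝-reflects Q | eq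
    ... | _ | _ | _      | ofʸ k | _    = k
    ... | _ | _ | ofⁿ ¬h | ofⁿ _ | refl = contradiction h ¬h

    Describes : (Form → Bool) → Form → Set ℓ
    Describes v φ = Reflects (M , w ⊨ φ) (v φ)

    eval-describes : ∀ v φ → All (Describes v) (atoms φ) → Describes (eval v) φ
    eval-describes v (` _)     (d ∷ []) = d
    eval-describes v (_ ≣ _)   (d ∷ []) = d
    eval-describes v (□ _ · _) (d ∷ []) = d
    eval-describes v ([ _ ] _) (d ∷ []) = d
    eval-describes v (~ φ)     ds       = ¬-reflects (eval-describes v φ ds)
    eval-describes v (φ & ψ)   ds       =
      eval-describes v φ (++⁻ˡ (atoms φ) ds) ×-reflects eval-describes v ψ (++⁻ʳ (atoms φ) ds)

    update-hit : ∀ v {b} φ → Reflects (M , w ⊨ φ) b → Describes (update v φ b) φ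
    update-hit v φ d with does (φ ≟ᶠ φ) | proof (φ ≟ᶠ φ)
    ... | true  | _       = d
    ... | false | ofⁿ φ≢φ = contradiction refl φ≢φ

    -- `atoms` may list a formula twice; if `ψ` is `φ` itself, the overwriting value is correct for
    -- it as well.
    update-keep : ∀ v {b} φ {ψ} → Reflects (M , w ⊨ φ) b → Describes v ψ → Describes (update v φ b) ψ
    update-keep v φ {ψ} d e with does (ψ ≟ᶠ φ) | proof (ψ ≟ᶠ φ)
    ... | true  | ofʸ refl = d
    ... | false | _        = e

    -- Excluded middle for a single formula holds under double negation, and finitely many such
    -- instances can be combined there.
    ¬¬-describable : ∀ φs → ¬ ¬ ∃ λ v → All (Describes v) φs
    ¬¬-describable []       k = k ((λ _ → false) , [])
    ¬¬-describable (φ ∷ φs) k =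
      ¬¬-describable φs λ (v , ds) →
      ¬¬-excluded-middle λ φ? →
      k ( update v φ (does φ?)
        , update-hit v φ (proof φ?) ∷ All.map (update-keep v φ (proof φ?)) ds )

    tautology-sound : ∀ φ → Tautology φ → M , w ⊨ φ
    -- The goal is stable, so a valuation that exists only under double negation suffices.
    tautology-sound φ t = ⊨-stable M w φ λ ¬h →
      ¬¬-describable (atoms φ) λ (v , ds) →
      ¬h (invert (subst (Reflects _) (t v) (eval-describes v φ ds)))

  -- Bisimulations and restricted models

  record Bisimulation {ℓ} (M N : Premodel ℓ) (_∼_ : World M → World N → Set ℓ) : Set ℓ where
    field
      ∼-V   : ∀ {w v} → w ∼ v → ∀ p → V M w p ≡ V N v p
      ∼-DEF : ∀ {w v} → w ∼ v → ∀ p → DEF M w p ≡ DEF N v p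
      forth : ∀ {w v} → w ∼ v → ∀ i w′ → R M i w w′ → ∃ λ v′ → R N i v v′ × w′ ∼ v′
      back  : ∀ {w v} → w ∼ v → ∀ i v′ → R N i v v′ → ∃ λ w′ → R M i w w′ × w′ ∼ v′

  open Bisimulation

  -- Negated and announced formulas are contravariant, so `transfer` has to run in both directions.
  converse : ∀ {ℓ} {M N : Premodel ℓ} {_∼_} → Bisimulation M N _∼_ → Bisimulation N M (flip _∼_)
  converse B .∼-V   z p = sym (∼-V B z p)
  converse B .∼-DEF z p = sym (∼-DEF B z p)
  converse B .forth     = back B
  converse B .back      = forth B

  restrict-bisimulation :
    ∀ {ℓ} {M N : Premodel ℓ} {_∼_} {S : World M → Set ℓ} {U : World N → Set ℓ} {s u} →
    Bisimulation M N _∼_ →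
    (∀ {w v} → w ∼ v → S w → U v) → (∀ {w v} → w ∼ v → U v → S w) →
    Bisimulation (restrict M S s) (restrict N U u) (λ x y → proj₁ x ∼ proj₁ y)
  restrict-bisimulation B f g .∼-V   z = ∼-V B z
  restrict-bisimulation B f g .∼-DEF z = ∼-DEF B z
  restrict-bisimulation B f g .forth z i (w′ , h) r with v′ , r′ , z′ ← forth B z i w′ r =
    (v′ , f z′ h) , r′ , z′
  restrict-bisimulation B f g .back  z i (v′ , h) r with w′ , r′ , z′ ← back B z i v′ r =
    (w′ , g z′ h) , r′ , z′

  transfer : ∀ {ℓ} {M N : Premodel ℓ} {_∼_} → Bisimulation M N _∼_ →
             ∀ φ {w v} → w ∼ v → M , w ⊨ φ → N , v ⊨ φ
  transfer B (` p) z (lift h) = lift (trans (sym (∼-V B z p)) h)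
  transfer B (P ≣ Q) z (lift h) =
    lift (trans (sym (def-cong (∼-DEF B z) P)) (trans h (def-cong (∼-DEF B z) Q)))
  transfer B (~ φ) z ¬h h = ¬h (transfer (converse B) φ z h)
  transfer B (φ & ψ) z (h , k) = transfer B φ z h , transfer B ψ z k
  transfer B (□ i · φ) z f v′ r with w′ , r′ , z′ ← back B z i v′ r =
    transfer B φ z′ (f w′ r′)
  transfer B ([ φ ] ψ) z f h =
    -- By induction related worlds agree on `φ`, so they survive the announcement together.
    transfer (restrict-bisimulation B (transfer B φ) (transfer (converse B) φ)) ψ z
             (f (transfer (converse B) φ z h))

  identity : ∀ {ℓ} (M : Premodel ℓ) → Bisimulation M M _≡_
  identity M .∼-V   refl _      = refl
  identity M .∼-DEF refl _      = refl
  identity M .forth refl i v r  = v , r , refl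
  identity M .back  refl i v r  = v , r , refl

  -- A bisimulation sees neither the proof carried by a world nor the designated inhabitant of the
  -- restriction.
  restrict-irrelevant : ∀ {ℓ} (M : Premodel ℓ) (S : World M → Set ℓ) {s s′ w h h′} φ →
                        restrict M S s , (w , h) ⊨ φ → restrict M S s′ , (w , h′) ⊨ φ
  restrict-irrelevant M S {s} {s′} φ =
    transfer (restrict-bisimulation {s = s} {u = s′} (identity M)
                (λ { refl h → h }) (λ { refl h → h })) φ refl

  restrict-restrict :
    ∀ {ℓ} (M : Premodel ℓ) φ ψ {s t u} →
    Bisimulation (restrict (restrict M (λ v → M , v ⊨ φ) s)
                           (λ x → restrict M (λ v → M , v ⊨ φ) s , x ⊨ ψ) t)
                 (restrict M (λ v → M , v ⊨ φ & ([ φ ] ψ)) u)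
                 (λ x y → proj₁ (proj₁ x) ≡ proj₁ y)
  restrict-restrict M φ ψ .∼-V   refl _ = refl
  restrict-restrict M φ ψ .∼-DEF refl _ = refl
  restrict-restrict M φ ψ .forth refl i ((v , h) , k) r =
    -- `[ φ ] ψ` asks for `ψ` under every proof `h′` of `φ`, whereas `k` gives it at the particular
    -- proof `h`.
    (v , h , λ h′ → restrict-irrelevant M _ ψ k) , r , refl
  restrict-restrict M φ ψ .back  refl i (v , h , k) r =
    ((v , h) , restrict-irrelevant M _ ψ (k h)) , r , refl

  -- Soundness by induction on derivations

  sound : ∀ {φ} → ⊢ φ → ∀ {ℓ} (M : Premodel ℓ) → IsModel M → ∀ w → M , w ⊨ φ
  sound (taut t) M m w = tautology-sound M w _ t
  sound (K i φ ψ) M m w =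
    ⇒-intro M w (□ i · (φ ⇒ ψ)) (□ i · φ ⇒ □ i · ψ) λ f →
    ⇒-intro M w (□ i · φ) (□ i · ψ) λ g v r →
    ⇒-elim M v φ ψ (f v r) (g v r)
  sound (ann-letter φ p) M m w =
    ⇔-intro M w ([ φ ] (` p)) (φ ⇒ ` p) (⇒-intro M w φ (` p)) (⇒-elim M w φ (` p))
  sound (ann-≣ φ P Q) M m w =
    ⇔-intro M w ([ φ ] (P ≣ Q)) (φ ⇒ (P ≣ Q)) (⇒-intro M w φ (P ≣ Q)) (⇒-elim M w φ (P ≣ Q))
  sound (ann-~ φ ψ) M m w =
    ⇔-intro M w ([ φ ] (~ ψ)) (φ ⇒ ~ ([ φ ] ψ))
      (λ f → ⇒-intro M w φ (~ ([ φ ] ψ)) λ h g → f h (g h))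
      (λ f h k → ⇒-elim M w φ (~ ([ φ ] ψ)) f h λ h′ → restrict-irrelevant M _ ψ k)
  sound (ann-& φ ψ θ) M m w =
    ⇔-intro M w ([ φ ] (ψ & θ)) (([ φ ] ψ) & ([ φ ] θ))
      (λ f → proj₁ ∘ f , proj₂ ∘ f)
      (λ (f , g) h → f h , g h)
  sound (ann-□ φ i ψ) M m w =
    ⇔-intro M w ([ φ ] (□ i · ψ)) (φ ⇒ □ i · (φ ⇒ [ φ ] ψ))
      (λ f → ⇒-intro M w φ (□ i · (φ ⇒ [ φ ] ψ)) λ h v r →
             ⇒-intro M v φ ([ φ ] ψ) λ _ k →
             restrict-irrelevant M _ ψ (f h (v , k) r))
      (λ f h (v , k) r →
         restrict-irrelevant M _ ψ
           -- The first `k` discharges the inner implication, the second makes the announcement true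
           -- at `v`.
           (⇒-elim M v φ ([ φ ] ψ) (⇒-elim M w φ (□ i · (φ ⇒ [ φ ] ψ)) f h v r) k k))
  sound (ann-ann φ ψ ξ) M m w =
    ⇔-intro M w ([ φ ] ([ ψ ] ξ)) ([ φ & ([ φ ] ψ) ] ξ)
      (λ f (h , k) → transfer (restrict-restrict M φ ψ) ξ refl (f h (k h)))
      (λ f h k → transfer (converse (restrict-restrict M φ ψ)) ξ refl
                   (f (h , λ h′ → restrict-irrelevant M _ ψ k)))
  sound (≣-refl P) M m w = lift refl
  sound (≣-sym P Q) M m w = ⇒-intro M w (P ≣ Q) (Q ≣ P) λ (lift e) → lift (sym e)
  sound (≣-trans P Q R) M m w =
    ⇒-intro M w ((P ≣ Q) & (Q ≣ R)) (P ≣ R) λ (lift d , lift e) → lift (trans d e)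
  sound (≣-equiv P Q) M m w =
    ⇒-intro M w (P ≣ Q) (⌜ P ⌝ ⇔ ⌜ Q ⌝) λ (lift e) →
    -- Condition (1) on models enters here.
    let eq = IsModel.respectsDef m w P Q e in
    ⇔-intro M w ⌜ P ⌝ ⌜ Q ⌝ (⌜⌝-transfer M w P Q eq) (⌜⌝-transfer M w Q P (sym eq))
  sound (≣-subst k p Q R S) M m w =
    ⇒-intro M w ((` p ≣ Q) & (R ≣ S)) (R ≣ [ k ∶ p ↦ Q ] S) λ (lift d , lift e) →
    lift (trans e (def-subst (DEF M w) k p Q d S))
  sound (≣-~ P Q) M m w =
    ⇔-intro M w (~ P ≣ ~ Q) (P ≣ Q)
      (λ (lift e) → lift (~-injective e))
      (λ (lift e) → lift (cong ~_ e))
    where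
    ~-injective : ∀ {P Q : BForm} → ~ P ≡ ~ Q → P ≡ Q
    ~-injective refl = refl
  sound (≣-& P Q R S) M m w =
    ⇔-intro M w ((P & Q) ≣ (R & S)) ((P ≣ R) & (Q ≣ S))
      (λ (lift e) → let d , d′ = &-injective e in lift d , lift d′)
      (λ (lift d , lift e) → lift (cong₂ _&_ d e))
    where
    &-injective : ∀ {P Q R S : BForm} → P & Q ≡ R & S → P ≡ R × Q ≡ S
    &-injective refl = refl , refl
  -- `def` preserves the outermost connective, so a negation would have to equal a conjunction.
  sound (≣-mismatch P Q R) M m w ()
  sound (≣-noncirc p P o P≢p) M m w (lift e) = def-noncircular (DEF M w) o P≢p e
  sound (mp {φ} {ψ} d e) M m w = ⇒-elim M w φ ψ (sound e M m w) (sound d M m w)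
  sound (nec i d) M m w v r = sound d M m v

theorem1 : (Letter : Set) (countable : Letter ↣ ℕ) (Agent : Set) (n : ℕ) (finite : Agent ↔ Fin n) →
    let open SPALD Letter countable Agent in
    (φ : Form) → ⊢ φ →
    {ℓ : Level} (M : Model ℓ) (w : World (premodel M)) → premodel M , w ⊨ φ
theorem1 Letter countable Agent n finite φ d M w =
  Soundness.sound Letter countable Agent _≟ᴬ_ d (premodel M) (isModel M) w
  where
  open SPALD Letter countable Agent

  -- Finiteness makes agents comparable, hence also formulas, which `update` compares.
  _≟ᴬ_ : DecidableEquality Agent
  _≟ᴬ_ = via-injection (↔⇒↣ finite) Fin._≟_
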